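{- For every positive integer $\ell$, every $P_5$-free graph that has no induced subgraph isomorphic to $K_{\ell,\ell}$ has tree-independence number at most $4\ell$.
   Context: All graphs are finite, simple and undirected. $P_5$ is the path on $5$ vertices; a graph is $H$-free if it has no induced subgraph isomorphic to $H$. $K_{\ell,\ell}$ is the complete bipartite graph with both parts of size $\ell$. A tree-decomposition of a graph $G$ is a pair $(T,\{B_t\}_{t\in V(T)})$ where $T$ is a tree and each $B_t\subseteq V(G)$, such that for every vertex $v$ the set of nodes $t$ with $v\in B_t$ is nonempty and induces a connected subtree of $T$, and for every edge $uv$ some bag contains both $u$ and $v$. Its independence number is $\max_t \alpha(G[B_t])$, where $\alpha$ denotes the maximum size of an independent set. The tree-independence number of $G$ is the minimum independence number over all tree-decompositions of $G$. -}

module Defs where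

open import Data.Nat using (ℕ; zero; suc; _+_; _≤_; _<ᵇ_; _≡ᵇ_)
open import Data.Fin using (Fin; toℕ) renaming (zero to fz; suc to fs)
open import Data.Bool using (Bool; true; false; _∨_; _xor_)
open import Data.Bool.Properties using (∨-comm; xor-same)
open import Data.List using (List; []; _∷_; _++_; length)
open import Data.List.Membership.Propositional using (_∈_)
open import Data.List.Relation.Unary.All using (All)
open import Data.List.Relation.Unary.Unique.Propositional using (Unique)
open import Data.List.Relation.Unary.Linked using (Linked)
open import Data.Product using (Σ; _×_; ∃; ∃-syntax)
open import Function.Definitions using (Injective)
open import Relation.Nullary using (¬_)
open import Relation.Binary.PropositionalEquality using (_≡_; refl)

record Graph (n : ℕ) : Set where
  field
    adj    : Fin n → Fin n → Bool
    sym    : ∀ i j → adj i j ≡ adj j i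
    irrefl : ∀ i → adj i i ≡ false
open Graph public

Adj : ∀ {n} → Graph n → Fin n → Fin n → Set
Adj G u v = adj G u v ≡ true

InducedSubgraph : ∀ {k n} → Graph k → Graph n → Set
InducedSubgraph {k} {n} H G =
  Σ (Fin k → Fin n) λ f →
    Injective _≡_ _≡_ f × (∀ i j → adj G (f i) (f j) ≡ adj H i j)

Free : ∀ {k n} → Graph k → Graph n → Set
Free H G = ¬ InducedSubgraph H G

P5adj : Fin 5 → Fin 5 → Bool
P5adj i j = (suc (toℕ i) ≡ᵇ toℕ j) ∨ (suc (toℕ j) ≡ᵇ toℕ i)

P5irr : ∀ i → P5adj i i ≡ false
P5irr fz = refl
P5irr (fs fz) = refl
P5irr (fs (fs fz)) = refl
P5irr (fs (fs (fs fz))) = refl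
P5irr (fs (fs (fs (fs fz)))) = refl

P5 : Graph 5
P5 = record
  { adj = P5adj
  ; sym = λ i j → ∨-comm (suc (toℕ i) ≡ᵇ toℕ j) (suc (toℕ j) ≡ᵇ toℕ i)
  ; irrefl = P5irr
  }

Kadj : ∀ ℓ → Fin (ℓ + ℓ) → Fin (ℓ + ℓ) → Bool
Kadj ℓ i j = (toℕ i <ᵇ ℓ) xor (toℕ j <ᵇ ℓ)

xor-comm' : ∀ a b → a xor b ≡ b xor a
xor-comm' false false = refl
xor-comm' false true = refl
xor-comm' true false = refl
xor-comm' true true = refl

K : (ℓ : ℕ) → Graph (ℓ + ℓ)
K ℓ = record
  { adj = Kadj ℓ
  ; sym = λ i j → xor-comm' (toℕ i <ᵇ ℓ) (toℕ j <ᵇ ℓ)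
  ; irrefl = λ i → xor-same (toℕ i <ᵇ ℓ)
  }

data WalkIn {m} (T : Graph m) (S : Fin m → Set) : Fin m → Fin m → Set where
  here : ∀ {s} → S s → WalkIn T S s s
  step : ∀ {s u t} → S s → Adj T s u → WalkIn T S u t → WalkIn T S s t

InducesConnected : ∀ {m} → Graph m → (Fin m → Set) → Set
InducesConnected T S = ∀ s t → S s → S t → WalkIn T S s t

HasCycle : ∀ {m} → Graph m → Set
HasCycle T = ∃[ x ] ∃[ rest ]
  (2 ≤ length rest × Unique (x ∷ rest) × Linked (Adj T) (x ∷ rest ++ x ∷ []))

-- a tree: nonempty (enforced by the vertex count suc m), connected, acyclic
IsTree : ∀ {m} → Graph m → Set
IsTree T = InducesConnected T (λ _ → ⊤') × ¬ HasCycle T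
  where
    open import Data.Unit using () renaming (⊤ to ⊤')

IsIndepIn : ∀ {n} → Graph n → (Fin n → Bool) → List (Fin n) → Set
IsIndepIn G B xs =
  Unique xs × All (λ v → B v ≡ true) xs
  × (∀ {u v} → u ∈ xs → v ∈ xs → adj G u v ≡ false)

αBag≤ : ∀ {n} → Graph n → (Fin n → Bool) → ℕ → Set
αBag≤ G B k = ∀ xs → IsIndepIn G B xs → length xs ≤ k

record TreeDecomposition {n} (G : Graph n) : Set₁ where
  field
    m       : ℕ
    T       : Graph (suc m)
    isTree  : IsTree T
    bag     : Fin (suc m) → Fin n → Bool
    vertexConnected : ∀ v →
      (∃[ t ] bag t v ≡ true) × InducesConnected T (λ t → bag t v ≡ true)
    edgeCovered : ∀ u v → Adj G u v → ∃[ t ] (bag t u ≡ true × bag t v ≡ true)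

TDIndep≤ : ∀ {n} {G : Graph n} → TreeDecomposition G → ℕ → Set
TDIndep≤ {G = G} D k = ∀ t → αBag≤ G (TreeDecomposition.bag D t) k

TreeIndep≤ : ∀ {n} → Graph n → ℕ → Set₁
TreeIndep≤ G k = Σ (TreeDecomposition G) λ D → TDIndep≤ D k

{-# OPTIONS --safe #-}

-- Let A and B be connected and anticomplete to each other.  In a P₅-free graph a common
-- neighbour of A and B is complete to A or to B.  Hence, if α(A), α(B) ≥ ℓ, a separator all of whose
-- vertices see both A and B has independence number at most 2ℓ: otherwise ℓ independent
-- vertices of it are complete to A, or to B, and K_{ℓ,ℓ} appears.
--
-- Every set containing an independent set J with |J| > 2ℓ is split by such a separator of
-- independence number at most 2ℓ.  If some u ∈ J has α(N(u)) ≤ 2ℓ, take it inside N(u).  Otherwise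
-- choose independent I_u ⊆ N(u) with |I_u| > 2ℓ.  If for some u, v ∈ J both I_u − N(v) and I_v − N(u)
-- have at least ℓ vertices, they are anticomplete, and the two stars at u and v are separated as
-- above.  If there is no such pair, "|I_u − N(v)| < ℓ" is a tournament on J, so some u beats ℓ
-- vertices of J; their traces on I_u form a chain, and K_{ℓ,ℓ} appears.
--
-- The tree-decomposition grows by leaves.  If U is the set of vertices decomposed so far and P is a
-- component of G − U, the new bag is N(P) ∪ P when α(P) ≤ 2ℓ, and N(P) ∪ (S ∩ P) otherwise, where S is
-- a separator as above splitting P.  The invariant is that α(N(P)) ≤ 2ℓ and that each vertex of N(P)
-- has a neighbour outside N[P].  It persists because an independent subset of N(P′), for a component
-- P′ of P − S, lies in N(P) or in S: an element of each kind would be joined through P′ by a path that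
-- extends at both ends to an induced P₅.
module Submission where

open import Defs
open import Data.Nat using (ℕ; _≤_; _*_)
open import Algebra.Properties.CommutativeSemigroup using (x∙yz≈y∙xz)
open import Data.Bool using (Bool; true; false; not)
import Data.Bool.Properties as Bool
open import Data.Empty using (⊥; ⊥-elim)
open import Data.Fin using (Fin; toℕ; splitAt; _↑ˡ_; _↑ʳ_; inject≤; _≟_) renaming (zero to fz; suc to fs)
open import Data.Fin.Properties using (any?; splitAt⁻¹-↑ˡ; splitAt⁻¹-↑ʳ; toℕ<n; toℕ-injective; inject≤-injective; toℕ-↑ˡ; toℕ-↑ʳ)
open import Data.Fin.Subset as Subset using (∣_∣)
open import Data.Fin.Subset.Properties using (p⊂q⇒∣p∣<∣q∣)
open import Data.List using (List; []; _∷_; length; lookup; filter; map; _++_)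
open import Data.List.Properties using (length-map; map-++)
open import Data.List.Membership.Propositional using (_∈_; _∉_; find)
open import Data.List.Membership.Propositional.Properties using (∈-lookup; ∈-filter⁻)
import Data.List.Membership.DecPropositional as DecMembership
open import Data.List.Relation.Unary.Any using (here; there)
import Data.List.Relation.Unary.All as All
import Data.List.Relation.Unary.All.Properties as All
open import Data.List.Relation.Unary.All using (All; []; _∷_)
open import Data.List.Relation.Unary.AllPairs using ([]; _∷_)
open import Data.List.Relation.Unary.Linked using (Linked; _∷_)
import Data.List.Relation.Unary.Linked.Properties as Linked
open import Data.List.Relation.Unary.Unique.Propositional using (Unique)
import Data.List.Relation.Unary.Unique.Propositional.Properties as Unique
open import Data.Nat using (zero; suc; _+_; _<_; z≤n; s≤s; _<ᵇ_; _≤?_; _<?_; >-nonZero)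
open import Data.Nat.Induction using (Acc; acc; <-wellFounded)
open import Data.Nat.ListAction using (sum)
open import Data.Nat.Properties using (≤-trans; ≤-reflexive; ≤-<-trans; <⇒≤; <-irrefl; <-asym; <-cmp; n≤1+n; m≤n⇒m≤1+n; m≤m+n; ≮⇒≥; ≰⇒>; ≤⇒≯; <ᵇ⇒<; <⇒<ᵇ; +-suc; +-assoc; +-identityʳ; +-mono-≤; +-mono-<; +-monoʳ-≤; *-monoʳ-≤; *-monoʳ-<; *-distribˡ-+; +-commutativeSemigroup; module ≤-Reasoning)
open import Data.Nat.Solver using (module +-*-Solver)
open import Data.Product using (Σ; ∃; ∃₂; _×_; _,_; proj₁; proj₂)
open import Data.Sum using (_⊎_; inj₁; inj₂; [_,_]′)
open import Data.Unit using (tt)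
open import Data.Vec using (tabulate)
open import Data.Vec.Properties using ([]=⇒lookup; lookup⇒[]=; lookup∘tabulate)
open import Function using (_∘_)
open import Function.Bundles using (Equivalence)
open import Function.Definitions using (Injective)
open import Relation.Binary.Definitions using (tri<; tri≈; tri>)
open import Relation.Binary.PropositionalEquality using (_≡_; _≢_; refl; trans; cong; subst) renaming (sym to ≡-sym)
open import Relation.Nullary using (¬_; Dec; yes; no; contradiction; does)
open import Relation.Nullary.Decidable using (map′; dec-true; _×-dec_; _⊎-dec_; ¬?; decidable-stable)
open import Relation.Unary using (Decidable)

private variable
  n m : ℕ

-- Independent sets and induced subgraphs

filter-split : ∀ {A : Set} {P : A → Set} (P? : Decidable P) xs →
  length xs ≡ length (filter P? xs) + length (filter (¬? ∘ P?) xs)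
filter-split P? [] = refl
filter-split P? (x ∷ xs) with P? x
... | yes _ = cong suc (filter-split P? xs)
... | no _ = trans (cong suc (filter-split P? xs)) (≡-sym (+-suc _ _))

unique-lookup-injective : ∀ {A : Set} {xs : List A} → Unique xs → ∀ i j → lookup xs i ≡ lookup xs j → i ≡ j
unique-lookup-injective (_ ∷ _) fz fz _ = refl
unique-lookup-injective (x∉ ∷ _) fz (fs j) e = contradiction e (All.lookup x∉ (∈-lookup j))
unique-lookup-injective (x∉ ∷ _) (fs i) fz e = contradiction (≡-sym e) (All.lookup x∉ (∈-lookup i))
unique-lookup-injective (_ ∷ u) (fs i) (fs j) e = cong fs (unique-lookup-injective u i j e)

module _ (G : Graph n) where

  Adj? : ∀ u v → Dec (Adj G u v)
  Adj? u v = adj G u v Bool.≟ true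

  nonadj : ∀ {u v} → ¬ Adj G u v → adj G u v ≡ false
  nonadj = Bool.¬-not

  Adj-sym : ∀ {u v} → Adj G u v → Adj G v u
  Adj-sym {u} {v} e = trans (Graph.sym G v u) e

  Adj-irrefl : ∀ {u} → ¬ Adj G u u
  Adj-irrefl {u} e with trans (≡-sym e) (Graph.irrefl G u)
  ... | ()

  inducedP5 : ∀ {a b c d e} →
    Adj G a b → Adj G b c → Adj G c d → Adj G d e →
    ¬ Adj G a c → ¬ Adj G a d → ¬ Adj G a e → ¬ Adj G b d → ¬ Adj G b e → ¬ Adj G c e →
    InducedSubgraph P5 G
  inducedP5 {a} {b} {c} {d} {e} ab bc cd de ac ad ae bd be ce = f , inj , rows
    where
    f : Fin 5 → Fin n
    f fz = a
    f (fs fz) = b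
    f (fs (fs fz)) = c
    f (fs (fs (fs fz))) = d
    f (fs (fs (fs (fs fz)))) = e
    upper : ∀ i j → toℕ i < toℕ j → adj G (f i) (f j) ≡ P5adj i j
    upper fz (fs fz) _ = ab
    upper fz (fs (fs fz)) _ = nonadj ac
    upper fz (fs (fs (fs fz))) _ = nonadj ad
    upper fz (fs (fs (fs (fs fz)))) _ = nonadj ae
    upper (fs fz) (fs (fs fz)) _ = bc
    upper (fs fz) (fs (fs (fs fz))) _ = nonadj bd
    upper (fs fz) (fs (fs (fs (fs fz)))) _ = nonadj be
    upper (fs (fs fz)) (fs (fs (fs fz))) _ = cd
    upper (fs (fs fz)) (fs (fs (fs (fs fz)))) _ = nonadj ce
    upper (fs (fs (fs fz))) (fs (fs (fs (fs fz)))) _ = de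
    upper (fs _) (fs fz) (s≤s ())
    upper (fs (fs _)) (fs (fs fz)) (s≤s (s≤s ()))
    upper (fs (fs (fs _))) (fs (fs (fs fz))) (s≤s (s≤s (s≤s ())))
    upper (fs (fs (fs (fs _)))) (fs (fs (fs (fs fz)))) (s≤s (s≤s (s≤s (s≤s ()))))
    rows : ∀ i j → adj G (f i) (f j) ≡ P5adj i j
    rows i j with <-cmp (toℕ i) (toℕ j)
    ... | tri< i<j _ _ = upper i j i<j
    ... | tri≈ _ i≡j _ rewrite toℕ-injective i≡j = trans (Graph.irrefl G (f j)) (≡-sym (P5irr j))
    ... | tri> _ _ j<i = trans (Graph.sym G (f i) (f j)) (trans (upper j i j<i) (Graph.sym P5 j i))
    -- Preserving adjacency forces injectivity, as the rows of the adjacency matrix of P₅ are distinct.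
    separated : ∀ i j → (∀ k → P5adj i k ≡ P5adj j k) → i ≡ j
    separated fz fz _ = refl
    separated fz (fs fz) h with () ← h fz
    separated fz (fs (fs fz)) h with () ← h (fs (fs (fs fz)))
    separated fz (fs (fs (fs fz))) h with () ← h (fs fz)
    separated fz (fs (fs (fs (fs fz)))) h with () ← h (fs fz)
    separated (fs fz) fz h with () ← h fz
    separated (fs fz) (fs fz) _ = refl
    separated (fs fz) (fs (fs fz)) h with () ← h fz
    separated (fs fz) (fs (fs (fs fz))) h with () ← h fz
    separated (fs fz) (fs (fs (fs (fs fz)))) h with () ← h fz
    separated (fs (fs fz)) fz h with () ← h (fs (fs (fs fz)))
    separated (fs (fs fz)) (fs fz) h with () ← h fz
    separated (fs (fs fz)) (fs (fs fz)) _ = refl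
    separated (fs (fs fz)) (fs (fs (fs fz))) h with () ← h (fs fz)
    separated (fs (fs fz)) (fs (fs (fs (fs fz)))) h with () ← h (fs fz)
    separated (fs (fs (fs fz))) fz h with () ← h (fs fz)
    separated (fs (fs (fs fz))) (fs fz) h with () ← h fz
    separated (fs (fs (fs fz))) (fs (fs fz)) h with () ← h (fs fz)
    separated (fs (fs (fs fz))) (fs (fs (fs fz))) _ = refl
    separated (fs (fs (fs fz))) (fs (fs (fs (fs fz)))) h with () ← h (fs (fs fz))
    separated (fs (fs (fs (fs fz)))) fz h with () ← h (fs fz)
    separated (fs (fs (fs (fs fz)))) (fs fz) h with () ← h fz
    separated (fs (fs (fs (fs fz)))) (fs (fs fz)) h with () ← h (fs fz)
    separated (fs (fs (fs (fs fz)))) (fs (fs (fs fz))) h with () ← h (fs (fs fz))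
    separated (fs (fs (fs (fs fz)))) (fs (fs (fs (fs fz)))) _ = refl
    inj : Injective _≡_ _≡_ f
    inj {i} {j} e = separated i j
      λ k → trans (≡-sym (rows i k)) (trans (cong (λ v → adj G v (f k)) e) (rows j k))

  record Indep (xs : List (Fin n)) : Set where
    constructor indep
    field
      unique : Unique xs
      nonAdj : ∀ {u v} → u ∈ xs → v ∈ xs → ¬ Adj G u v
  open Indep public

  indep-filter : ∀ {P : Fin n → Set} (P? : Decidable P) {xs} → Indep xs → Indep (filter P? xs)
  indep-filter P? i = indep (Unique.filter⁺ P? (unique i))
    λ p q → nonAdj i (proj₁ (∈-filter⁻ P? p)) (proj₁ (∈-filter⁻ P? q))

  indep-tail : ∀ {x xs} → Indep (x ∷ xs) → Indep xs
  indep-tail (indep (_ ∷ u) h) = indep u λ p q → h (there p) (there q)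

  α≤ : (Fin n → Set) → ℕ → Set
  α≤ P k = ∀ {xs} → Indep xs → All P xs → length xs ≤ k

  HasIndep : (Fin n → Set) → ℕ → Set
  HasIndep P k = ∃ λ xs → Indep xs × All P xs × k ≤ length xs

  -- Recursion on `k` with a varying predicate: once `v` is chosen, the search goes on among the
  -- vertices of `P` that differ from `v` and are not adjacent to it.
  hasIndep? : ∀ {P} → Decidable P → ∀ k → Dec (HasIndep P k)
  hasIndep? P? zero = yes ([] , indep [] (λ ()) , [] , z≤n)
  hasIndep? {P} P? (suc k) = map′ to from
    (any? λ v → P? v ×-dec hasIndep? (λ u → P? u ×-dec (¬? (v ≟ u) ×-dec ¬? (Adj? v u))) k)
    where
    to : _ → HasIndep P (suc k)
    to (v , Pv , xs , i , h , le) = v ∷ xs ,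
      indep (All.map (proj₁ ∘ proj₂) h ∷ unique i) non , Pv ∷ All.map proj₁ h , s≤s le
      where
      non : ∀ {u w} → u ∈ v ∷ xs → w ∈ v ∷ xs → ¬ Adj G u w
      non (here refl) (here refl) = Adj-irrefl
      non (here refl) (there q) = proj₂ (proj₂ (All.lookup h q))
      non (there p) (here refl) = proj₂ (proj₂ (All.lookup h p)) ∘ Adj-sym
      non (there p) (there q) = nonAdj i p q
    from : HasIndep P (suc k) → _
    from (v ∷ xs , i@(indep (v∉ ∷ _) non) , Pv ∷ h , s≤s le) = v , Pv , xs , indep-tail i ,
      All.tabulate (λ p → All.lookup h p , All.lookup v∉ p , non (here refl) (there p)) , le

  α≤-or-large : ∀ {P} → Decidable P → ∀ k → α≤ P k ⊎ HasIndep P (suc k)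
  α≤-or-large P? k with hasIndep? P? (suc k)
  ... | yes h = inj₂ h
  ... | no ¬h = inj₁ λ {xs} i h → ≮⇒≥ λ lt → ¬h (xs , i , h , lt)

  α≤-mono : ∀ {P Q k} → (∀ {v} → P v → Q v) → α≤ Q k → α≤ P k
  α≤-mono P⊆Q αQ i h = αQ i (All.map P⊆Q h)

  α≤-∪ : ∀ {P Q R a b} → Decidable P → (∀ {v} → R v → P v ⊎ Q v) → α≤ P a → α≤ Q b → α≤ R (a + b)
  α≤-∪ {P} {Q} {R} P? R⊆ αP αQ {xs} i h = ≤-trans (≤-reflexive (filter-split P? xs)) (+-mono-≤
    (αP (indep-filter P? i) (All.all-filter P? xs))
    (αQ (indep-filter (¬? ∘ P?) i) (All.zipWith elim
      (All.filter⁺ (¬? ∘ P?) h , All.all-filter (¬? ∘ P?) xs))))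
    where
    elim : ∀ {v} → R v × ¬ P v → Q v
    elim (Rv , ¬Pv) with R⊆ Rv
    ... | inj₁ Pv = contradiction Pv ¬Pv
    ... | inj₂ Qv = Qv

  inducedBiclique : ∀ ℓ {xs ys} → Indep xs → Indep ys → ℓ ≤ length xs → ℓ ≤ length ys →
    (∀ {x y} → x ∈ xs → y ∈ ys → Adj G x y) → InducedSubgraph (K ℓ) G
  inducedBiclique ℓ {xs} {ys} ix iy ℓ≤x ℓ≤y complete = g ∘ splitAt ℓ , inj , adjacency
    where
    x : Fin ℓ → Fin n
    x i = lookup xs (inject≤ i ℓ≤x)
    y : Fin ℓ → Fin n
    y i = lookup ys (inject≤ i ℓ≤y)
    g : Fin ℓ ⊎ Fin ℓ → Fin n
    g = [ x , y ]′
    xy : ∀ i j → Adj G (x i) (y j)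
    xy i j = complete (∈-lookup (inject≤ i ℓ≤x)) (∈-lookup (inject≤ j ℓ≤y))
    g-injective : ∀ s t → g s ≡ g t → s ≡ t
    g-injective (inj₁ i) (inj₁ j) e = cong inj₁ (inject≤-injective ℓ≤x ℓ≤x i j (unique-lookup-injective (unique ix) _ _ e))
    g-injective (inj₁ i) (inj₂ j) e = contradiction (subst (λ v → Adj G v (y j)) e (xy i j)) Adj-irrefl
    g-injective (inj₂ i) (inj₁ j) e = contradiction (subst (λ v → Adj G v (y i)) (≡-sym e) (xy j i)) Adj-irrefl
    g-injective (inj₂ i) (inj₂ j) e = cong inj₂ (inject≤-injective ℓ≤y ℓ≤y i j (unique-lookup-injective (unique iy) _ _ e))
    -- Couples the outcome of `splitAt` with the Boolean comparison in `Kadj`, so that one case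
    -- distinction evaluates both sides of `adjacency`.
    data Split (i : Fin (ℓ + ℓ)) : Set where
      left : ∀ k → splitAt ℓ i ≡ inj₁ k → i ≡ k ↑ˡ ℓ → (toℕ i <ᵇ ℓ) ≡ true → Split i
      right : ∀ k → splitAt ℓ i ≡ inj₂ k → i ≡ ℓ ↑ʳ k → (toℕ i <ᵇ ℓ) ≡ false → Split i
    split : ∀ i → Split i
    split i with splitAt ℓ i in eq
    ... | inj₁ k = left k eq i≡ (Equivalence.to Bool.T-≡ (<⇒<ᵇ (subst (_< ℓ) (trans (≡-sym (toℕ-↑ˡ k ℓ)) (cong toℕ (≡-sym i≡))) (toℕ<n k))))
      where
      i≡ = ≡-sym (splitAt⁻¹-↑ˡ eq)
    ... | inj₂ k = right k eq i≡ (Bool.¬-not λ h → ≤⇒≯ (m≤m+n ℓ (toℕ k))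
        (subst (_< ℓ) (trans (cong toℕ i≡) (toℕ-↑ʳ ℓ k)) (<ᵇ⇒< (toℕ i) ℓ (Equivalence.from Bool.T-≡ h))))
      where
      i≡ = ≡-sym (splitAt⁻¹-↑ʳ {i = i} eq)
    inj : Injective _≡_ _≡_ (g ∘ splitAt ℓ)
    inj {i} {j} e with split i | split j | g-injective (splitAt ℓ i) (splitAt ℓ j) e
    ... | left k p q _ | left k′ p′ q′ _ | e′ with trans (≡-sym p) (trans e′ p′)
    ... | refl = trans q (≡-sym q′)
    inj e | right k p q _ | right k′ p′ q′ _ | e′ with trans (≡-sym p) (trans e′ p′)
    ... | refl = trans q (≡-sym q′)
    inj e | left _ p _ _ | right _ p′ _ _ | e′ with () ← trans (≡-sym p) (trans e′ p′)
    inj e | right _ p _ _ | left _ p′ _ _ | e′ with () ← trans (≡-sym p) (trans e′ p′)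
    adjacency : ∀ i j → adj G (g (splitAt ℓ i)) (g (splitAt ℓ j)) ≡ Kadj ℓ i j
    adjacency i j with split i | split j
    ... | left k p _ b | left k′ p′ _ b′ rewrite p | p′ | b | b′ = nonadj (nonAdj ix (∈-lookup _) (∈-lookup _))
    ... | left k p _ b | right k′ p′ _ b′ rewrite p | p′ | b | b′ = xy k k′
    ... | right k p _ b | left k′ p′ _ b′ rewrite p | p′ | b | b′ = Adj-sym (xy k′ k)
    ... | right k p _ b | right k′ p′ _ b′ rewrite p | p′ | b | b′ = nonadj (nonAdj iy (∈-lookup _) (∈-lookup _))

-- Adding a leaf to a tree

does⁻ : ∀ {A : Set} (a? : Dec A) → does a? ≡ true → A
does⁻ (yes a) _ = a

attach : Graph m → Fin m → Graph (suc m)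
attach {m} T p = record { adj = a ; sym = s ; irrefl = r }
  where
  a : Fin (suc m) → Fin (suc m) → Bool
  a fz fz = false
  a fz (fs j) = does (p ≟ j)
  a (fs i) fz = does (p ≟ i)
  a (fs i) (fs j) = adj T i j
  s : ∀ i j → a i j ≡ a j i
  s fz fz = refl
  s fz (fs j) = refl
  s (fs i) fz = refl
  s (fs i) (fs j) = Graph.sym T i j
  r : ∀ i → a i i ≡ false
  r fz = refl
  r (fs i) = irrefl T i

module _ {T : Graph m} {p : Fin m} where

  leaf-adj : ∀ {i} → Adj (attach T p) fz i → i ≡ fs p
  leaf-adj {fs i} e = cong fs (≡-sym (does⁻ (p ≟ i) e))

  leaf-adjʳ : ∀ {i} → Adj (attach T p) i fz → i ≡ fs p
  leaf-adjʳ {fs i} e = cong fs (≡-sym (does⁻ (p ≟ i) e))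

  module _ {S : Fin (suc m) → Set} where

    walk-lift : ∀ {s t} → WalkIn T (S ∘ fs) s t → WalkIn (attach T p) S (fs s) (fs t)
    walk-lift (here Ss) = here Ss
    walk-lift (step Ss e w) = step Ss e (walk-lift w)

    walk-snoc : ∀ {s u t} → WalkIn (attach T p) S s u → Adj (attach T p) u t → S t → WalkIn (attach T p) S s t
    walk-snoc (here Ss) e St = step Ss e (here St)
    walk-snoc (step Ss e w) e′ St = step Ss e (walk-snoc w e′ St)

    -- The leaf reaches old nodes only through `p`, so a connected `S` containing the leaf contains
    -- `p` or no old node at all. For bags these are the vertices kept from the parent and the
    -- vertices new in the leaf.
    attach-connected : InducesConnected T (S ∘ fs) →
      (S fz → S (fs p) ⊎ (∀ t → ¬ S (fs t))) → InducesConnected (attach T p) S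
    attach-connected conn leaf fz fz S₀ _ = here S₀
    attach-connected conn leaf fz (fs t) S₀ St with leaf S₀
    ... | inj₁ Sp = step S₀ (dec-true (p ≟ p) refl) (walk-lift (conn p t Sp St))
    ... | inj₂ ¬S = contradiction St (¬S t)
    attach-connected conn leaf (fs s) fz Ss S₀ with leaf S₀
    ... | inj₁ Sp = walk-snoc (walk-lift (conn s p Ss Sp)) (dec-true (p ≟ p) refl) S₀
    ... | inj₂ ¬S = contradiction Ss (¬S s)
    attach-connected conn leaf (fs s) (fs t) Ss St = walk-lift (conn s t Ss St)

  private
    R = Adj (attach T p)

  linked-last : ∀ {y ys z} → Linked R (y ∷ ys ++ z ∷ []) → ∃ λ w → w ∈ y ∷ ys × R w z
  linked-last {ys = []} (e ∷ _) = _ , here refl , e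
  linked-last {ys = _ ∷ _} (_ ∷ l) with linked-last l
  ... | w , w∈ , e = w , there w∈ , e

  -- Both neighbours of the leaf on the walk are its parent.
  leaf-last : ∀ {y ys z} → Linked R (y ∷ ys ++ z ∷ []) → Unique (y ∷ ys) → fz ∈ ys →
    (ys ≡ fz ∷ [] × y ≡ z) ⊎ z ∈ ys
  leaf-last {ys = .fz ∷ []} (e ∷ e′ ∷ _) _ (here refl) =
    inj₁ (refl , trans (leaf-adjʳ e) (≡-sym (leaf-adj e′)))
  leaf-last {ys = .fz ∷ _ ∷ _} (e ∷ e′ ∷ _) ((_ ∷ y≢ ∷ _) ∷ _) (here refl) =
    contradiction (trans (leaf-adjʳ e) (≡-sym (leaf-adj e′))) y≢
  leaf-last {ys = _ ∷ _} (_ ∷ l) (_ ∷ u) (there q) with leaf-last l u q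
  ... | inj₁ (_ , refl) = inj₂ (here refl)
  ... | inj₂ z∈ = inj₂ (there z∈)

  unlift : ∀ {xs : List (Fin (suc m))} → fz ∉ xs → ∃ λ ys → xs ≡ map fs ys
  unlift {[]} _ = [] , refl
  unlift {fz ∷ _} fz∉ = contradiction (here refl) fz∉
  unlift {fs x ∷ _} fz∉ with unlift (fz∉ ∘ there)
  ... | ys , refl = x ∷ ys , refl

  -- The leaf has a single neighbour, so a cycle through it would repeat the parent; a cycle
  -- avoiding it is the image of a cycle of `T`. The leaf may open the cyclic list or occur inside
  -- it, hence the separate cases.
  attach-acyclic : ¬ HasCycle T → ¬ HasCycle (attach T p)
  attach-acyclic acyc (fz , _ ∷ _ ∷ _ , _ , (_ ∷ (r∉ ∷ _)) , (e ∷ _ ∷ l)) with linked-last l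
  ... | w , w∈ , e′ = All.lookup r∉ w∈
    (trans (leaf-adj e) (≡-sym (leaf-adjʳ e′)))
  attach-acyclic acyc (fz , _ ∷ [] , s≤s () , _)
  attach-acyclic acyc (fs x , rest , 2≤ , u , l) with DecMembership._∈?_ _≟_ fz rest
  attach-acyclic acyc (fs x , rest , 2≤ , u@(x∉ ∷ _) , l) | yes fz∈ with leaf-last l u fz∈ | 2≤
  ... | inj₁ (refl , _) | s≤s ()
  ... | inj₂ x∈ | _ = All.lookup x∉ x∈ refl
  attach-acyclic acyc (fs x , rest , 2≤ , u , l) | no fz∉ with unlift fz∉
  ... | ys , refl = acyc (x , ys , subst (2 ≤_) (length-map fs ys) 2≤ , Unique.map⁻ {xs = x ∷ ys} u ,
    Linked.map⁻ (subst (Linked R) (cong (fs x ∷_) (≡-sym (map-++ fs ys (x ∷ [])))) l))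

attach-isTree : ∀ {T : Graph m} {p} → IsTree T → IsTree (attach T p)
attach-isTree (conn , acyc) = attach-connected conn (λ _ → inj₁ tt) , attach-acyclic acyc

point : Graph 1
point = record { adj = λ _ _ → false ; sym = λ _ _ → refl ; irrefl = λ _ → refl }

point-connected : ∀ {S} → InducesConnected point S
point-connected fz fz S₀ _ = here S₀

point-isTree : IsTree point
point-isTree = point-connected , λ { (_ , _ ∷ _ , _ , _ , () ∷ _) ; (_ , [] , () , _) }

-- Connected sets and components

VSet : ℕ → Set
VSet n = Fin n → Bool


infix 4 _∋_ _∋?_
_∋_ : VSet n → Fin n → Set
A ∋ v = A v ≡ true

_∋?_ : (A : VSet n) → Decidable (A ∋_)
A ∋? v = A v Bool.≟ true

abstract
  ⟪_⟫ : {P : Fin n → Set} → Decidable P → VSet n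
  ⟪ P? ⟫ v = does (P? v)

  ∈⁺ : {P : Fin n → Set} (P? : Decidable P) → ∀ {v} → P v → ⟪ P? ⟫ ∋ v
  ∈⁺ P? {v} = dec-true (P? v)

  ∈⁻ : {P : Fin n → Set} (P? : Decidable P) → ∀ {v} → ⟪ P? ⟫ ∋ v → P v
  ∈⁻ P? {v} = does⁻ (P? v)

∁ : VSet n → VSet n
∁ A = not ∘ A

∈∁⁺ : (A : VSet n) → ∀ {v} → ¬ A ∋ v → ∁ A ∋ v
∈∁⁺ A {v} ¬v with A v
... | false = refl
... | true = contradiction refl ¬v

∈∁⁻ : (A : VSet n) → ∀ {v} → ∁ A ∋ v → ¬ A ∋ v
∈∁⁻ A {v} e e′ with A v
∈∁⁻ A {v} () _ | true

size : VSet n → ℕ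
size A = ∣ tabulate A ∣

size-strict : (A B : VSet n) → (∀ {v} → A ∋ v → B ∋ v) → ∀ {x} → B ∋ x → ¬ A ∋ x → size A < size B
size-strict A B A⊆B {x} Bx ¬Ax =
  p⊂q⇒∣p∣<∣q∣ {p = tabulate A} {tabulate B} ((λ p → into B (A⊆B (out A p))) , x , into B Bx , ¬Ax ∘ out A)
  where
  out : ∀ A {v} → v Subset.∈ tabulate A → A ∋ v
  out A {v} p = trans (≡-sym (lookup∘tabulate A v)) ([]=⇒lookup p)
  into : ∀ A {v} → A ∋ v → v Subset.∈ tabulate A
  into A {v} e = lookup⇒[]= v (tabulate A) (trans (lookup∘tabulate A v) e)

-- The size of the complement is the termination measure, both for growing a component and for
-- growing the decomposition.
size-∁-strict : (A B : VSet n) → (∀ {v} → A ∋ v → B ∋ v) → ∀ {x} → B ∋ x → ¬ A ∋ x → size (∁ B) < size (∁ A)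
size-∁-strict A B A⊆B Bx ¬Ax = size-strict (∁ B) (∁ A)
  (λ p → ∈∁⁺ A (∈∁⁻ B p ∘ A⊆B)) (∈∁⁺ A ¬Ax) (λ q → ∈∁⁻ B q Bx)

module _ (G : Graph n) where

  private
    infix 4 _~_ _~?_
    _~_ = Adj G
    _~?_ = Adj? G
    ~-sym : ∀ {u v} → u ~ v → v ~ u
    ~-sym = Adj-sym G

  Touches : VSet n → Fin n → Set
  Touches A v = ∃ λ a → A ∋ a × a ~ v

  touches? : ∀ A → Decidable (Touches A)
  touches? A v = any? λ a → A ∋? a ×-dec a ~? v

  -- The open neighbourhood N(A); `Touches A` alone may also hold at vertices of `A`.
  Boundary : VSet n → Fin n → Set
  Boundary A v = ¬ A ∋ v × Touches A v

  boundary? : ∀ A → Decidable (Boundary A)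
  boundary? A v = ¬? (A ∋? v) ×-dec touches? A v

  -- Connectivity through cuts, which makes it usable without handling paths.
  Connected : VSet n → Set₁
  Connected A = ∀ {Q : Fin n → Set} → Decidable Q → ∀ {a b} → A ∋ a → Q a → A ∋ b → ¬ Q b →
    ∃₂ λ x y → A ∋ x × Q x × A ∋ y × ¬ Q y × x ~ y

  -- Otherwise the cut of `C` by `A` would be crossed by an edge, against closure. This is how a
  -- connected set is placed inside a closed one that it meets.
  connected-⊆ : ∀ {A C a} → Connected C → A ∋ a → C ∋ a →
    (∀ {x y} → A ∋ x → C ∋ x → C ∋ y → x ~ y → A ∋ y) → ∀ {y} → C ∋ y → A ∋ y
  connected-⊆ {A} conn Aa Ca closed {y} Cy with A ∋? y
  ... | yes Ay = Ay
  ... | no ¬Ay with conn (A ∋?_) Ca Aa Cy ¬Ay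
  ... | x , z , Cx , Ax , Cz , ¬Az , x~z = contradiction (closed Ax Cx Cz x~z) ¬Az

  star-connected : ∀ {A c} → A ∋ c → (∀ {a} → A ∋ a → a ≡ c ⊎ c ~ a) → Connected A
  star-connected {A} {c} Ac star Q? {a} {b} Aa Qa Ab ¬Qb with Q? c
  ... | yes Qc with star Ab
  ... | inj₁ refl = contradiction Qc ¬Qb
  ... | inj₂ c~b = c , b , Ac , Qc , Ab , ¬Qb , c~b
  star-connected {A} {c} Ac star Q? {a} {b} Aa Qa Ab ¬Qb | no ¬Qc with star Aa
  ... | inj₁ refl = contradiction Qa ¬Qc
  ... | inj₂ c~a = a , c , Aa , Qa , Ac , ¬Qc , ~-sym c~a

  insert? : ∀ (A : VSet n) y → Decidable (λ v → A ∋ v ⊎ v ≡ y)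
  insert? A y v = A ∋? v ⊎-dec v ≟ y

  insert : VSet n → Fin n → VSet n
  insert A y = ⟪ insert? A y ⟫

  insert-connected : ∀ {A x y} → Connected A → A ∋ x → x ~ y → Connected (insert A y)
  insert-connected {A} {x} {y} conn Ax x~y Q? {a} {b} Aa Qa Ab ¬Qb
    with ∈⁻ (insert? A y) Aa | ∈⁻ (insert? A y) Ab
  ... | inj₂ refl | inj₂ refl = contradiction Qa ¬Qb
  ... | inj₁ Aa′ | inj₁ Ab′ with conn Q? Aa′ Qa Ab′ ¬Qb
  ... | u , v , Au , Qu , Av , ¬Qv , u~v =
    u , v , ∈⁺ (insert? A y) (inj₁ Au) , Qu , ∈⁺ (insert? A y) (inj₁ Av) , ¬Qv , u~v
  insert-connected {A} {x} {y} conn Ax x~y Q? {a} {b} Aa Qa Ab ¬Qb | inj₁ Aa′ | inj₂ refl with Q? x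
  ... | yes Qx = x , y , ∈⁺ (insert? A y) (inj₁ Ax) , Qx , Ab , ¬Qb , x~y
  ... | no ¬Qx with conn Q? Aa′ Qa Ax ¬Qx
  ... | u , v , Au , Qu , Av , ¬Qv , u~v =
    u , v , ∈⁺ (insert? A y) (inj₁ Au) , Qu , ∈⁺ (insert? A y) (inj₁ Av) , ¬Qv , u~v
  insert-connected {A} {x} {y} conn Ax x~y Q? {a} {b} Aa Qa Ab ¬Qb | inj₂ refl | inj₁ Ab′ with Q? x
  ... | no ¬Qx = y , x , Aa , Qa , ∈⁺ (insert? A y) (inj₁ Ax) , ¬Qx , ~-sym x~y
  ... | yes Qx with conn Q? Ax Qx Ab′ ¬Qb
  ... | u , v , Au , Qu , Av , ¬Qv , u~v =
    u , v , ∈⁺ (insert? A y) (inj₁ Au) , Qu , ∈⁺ (insert? A y) (inj₁ Av) , ¬Qv , u~v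

  record Component (A : VSet n) (p : Fin n) : Set₁ where
    field
      part : VSet n
      base : part ∋ p
      part⊆ : ∀ {v} → part ∋ v → A ∋ v
      connected : Connected part
      closed : ∀ {x y} → part ∋ x → A ∋ y → x ~ y → part ∋ y

  abstract
    component : ∀ A {p} → A ∋ p → Component A p
    component A {p} Ap = grow ⟪ _≟ p ⟫ (<-wellFounded _) (∈⁺ (_≟ p) refl)
      (λ {v} e → subst (A ∋_) (≡-sym (∈⁻ (_≟ p) e)) Ap)
      (star-connected (∈⁺ (_≟ p) refl) (λ {a} e → inj₁ (∈⁻ (_≟ p) e)))
      where
      grow : ∀ C → Acc _<_ (size (∁ C)) → C ∋ p → (∀ {v} → C ∋ v → A ∋ v) → Connected C → Component A p
      grow C (acc rec) Cp C⊆A conn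
        with any? (λ y → A ∋? y ×-dec ¬? (C ∋? y) ×-dec touches? C y)
      ... | no stuck = record
        { part = C ; base = Cp ; part⊆ = C⊆A ; connected = conn
        ; closed = λ {x} {y} Cx Ay x~y → decidable-stable (C ∋? y) λ ¬Cy → stuck (y , Ay , ¬Cy , x , Cx , x~y) }
      ... | yes (y , Ay , ¬Cy , x , Cx , x~y) = grow (insert C y)
        (rec (size-∁-strict C (insert C y) (λ {v} Cv → ∈⁺ (insert? C y) (inj₁ Cv))
          (∈⁺ (insert? C y) (inj₂ refl)) ¬Cy))
        (∈⁺ (insert? C y) (inj₁ Cp))
        (λ {v} e → [ C⊆A , (λ { refl → Ay }) ]′ (∈⁻ (insert? C y) e))
        (insert-connected conn Cx x~y)

  near? : ∀ A w → Decidable (λ v → w ~ v ⊎ ∃ λ z → A ∋ z × w ~ z × z ~ v)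
  near? A w v = w ~? v ⊎-dec any? λ z → A ∋? z ×-dec w ~? z ×-dec z ~? v

  -- Connected sets in a P₅-free graph

  module _ (P5-free : Free P5 G) where

    -- If `s` misses a vertex in each set, connectivity yields an edge `x y` of `A` with only `x`
    -- adjacent to `s`, and likewise `z t` in `B`. Then `y x s z t` is an induced P₅.
    complete-to-one : ∀ {A B s} → Connected A → Connected B → (∀ {a b} → A ∋ a → B ∋ b → ¬ a ~ b) →
      Touches A s → Touches B s → (∀ {a} → A ∋ a → s ~ a) ⊎ (∀ {b} → B ∋ b → s ~ b)
    complete-to-one {A} {B} {s} connA connB anti (a , Aa , a~s) (b , Bb , b~s)
      with any? (λ v → A ∋? v ×-dec ¬? (s ~? v)) | any? (λ v → B ∋? v ×-dec ¬? (s ~? v))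
    ... | no full | _ = inj₁ λ {v} Av → decidable-stable (s ~? v) λ ¬s~v → full (v , Av , ¬s~v)
    ... | yes _ | no full = inj₂ λ {v} Bv → decidable-stable (s ~? v) λ ¬s~v → full (v , Bv , ¬s~v)
    ... | yes (a′ , Aa′ , ¬s~a′) | yes (b′ , Bb′ , ¬s~b′)
      with connA (s ~?_) Aa (~-sym a~s) Aa′ ¬s~a′ | connB (s ~?_) Bb (~-sym b~s) Bb′ ¬s~b′
    ... | x , y , Ax , s~x , Ay , ¬s~y , x~y | z , t , Bz , s~z , Bt , ¬s~t , z~t =
      contradiction (inducedP5 G (~-sym x~y) (~-sym s~x) s~z z~t
        (¬s~y ∘ ~-sym) (anti Ay Bz) (anti Ay Bt) (anti Ax Bz) (anti Ax Bt) ¬s~t) P5-free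

    -- If w and x have a common neighbour z in A, the path is c w z x r.  Otherwise it consists of c
    -- and the first four vertices of a shortest path from w through A, towards x if every vertex of A
    -- is within distance two of w.
    bridge : ∀ {A w x c r} → Connected A → Touches A w → Touches A x → ¬ w ~ x →
      c ~ w → (∀ {a} → A ∋ a → ¬ c ~ a) → ¬ c ~ x →
      r ~ x → (∀ {a} → A ∋ a → ¬ a ~ r) → ¬ w ~ r → ¬ c ~ r → ⊥
    bridge {A} {w} {x} {c} {r} conn (p , Ap , p~w) (q , Aq , q~x) ¬w~x c~w ¬c~A ¬c~x r~x ¬A~r ¬w~r ¬c~r
      with any? (λ z → A ∋? z ×-dec w ~? z ×-dec z ~? x)
    ... | yes (z , Az , w~z , z~x) = P5-free
      (inducedP5 G c~w w~z z~x (~-sym r~x) (¬c~A Az) ¬c~x ¬c~r ¬w~x ¬w~r (¬A~r Az))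
    ... | no noCommon with any? (λ v → A ∋? v ×-dec ¬? (near? A w v))
    ... | yes (v , Av , far) with conn (near? A w) Ap (inj₁ (~-sym p~w)) Av far
    ... | x′ , y , Ax′ , inj₁ w~x′ , Ay , ¬near , x′~y = ¬near (inj₂ (x′ , Ax′ , w~x′ , x′~y))
    ... | x′ , y , Ax′ , inj₂ (z , Az , w~z , z~x′) , Ay , ¬near , x′~y = P5-free
      (inducedP5 G c~w w~z z~x′ x′~y (¬c~A Az) (¬c~A Ax′) (¬c~A Ay)
        (λ w~x′ → ¬near (inj₂ (x′ , Ax′ , w~x′ , x′~y))) (¬near ∘ inj₁)
        (λ z~y → ¬near (inj₂ (z , Az , w~z , z~y))))
    bridge {A} {w} {x} {c} {r} conn (p , Ap , p~w) (q , Aq , q~x) ¬w~x c~w ¬c~A ¬c~x r~x ¬A~r ¬w~r ¬c~r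
        | no noCommon | no allNear with decidable-stable (near? A w q) (λ ¬near → allNear (q , Aq , ¬near))
    ... | inj₁ w~q = noCommon (q , Aq , w~q , q~x)
    ... | inj₂ (z , Az , w~z , z~q) = P5-free
      (inducedP5 G c~w w~z z~q q~x (¬c~A Az) (¬c~A Aq) ¬c~x
        (λ w~q → noCommon (q , Aq , w~q , q~x)) ¬w~x (λ z~x → noCommon (z , Az , w~z , z~x)))

-- Separators of small independence number

module Tournament {A : Set} {R : A → A → Set} (R? : ∀ u v → Dec (R u v)) where

  score : A → List A → ℕ
  score u = length ∘ filter (R? u)

  losses : A → List A → ℕ
  losses v = length ∘ filter (λ u → R? u v)

  total : List A → List A → ℕ
  total us vs = sum (map (λ u → score u vs) us)

  total-cons : ∀ x us vs → total us (x ∷ vs) ≡ losses x us + total us vs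
  total-cons x [] vs = refl
  total-cons x (u ∷ us) vs with R? u x
  ... | yes _ = cong suc (trans (cong (score u vs +_) (total-cons x us vs)) (x∙yz≈y∙xz +-commutativeSemigroup (score u vs) (losses x us) _))
  ... | no _ = trans (cong (score u vs +_) (total-cons x us vs)) (x∙yz≈y∙xz +-commutativeSemigroup (score u vs) (losses x us) _)

  score+losses : ∀ x {us} → All (λ u → R x u ⊎ R u x) us → length us ≤ score x us + losses x us
  score+losses x [] = z≤n
  score+losses x {u ∷ us} (r ∷ rs) with R? x u | R? u x | r
  ... | yes _ | yes _ | _ = s≤s (≤-trans (score+losses x rs) (+-monoʳ-≤ _ (n≤1+n _)))
  ... | yes _ | no _ | _ = s≤s (score+losses x rs)
  ... | no _ | yes _ | _ = ≤-trans (s≤s (score+losses x rs)) (≤-reflexive (≡-sym (+-suc _ _)))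
  ... | no ¬r | no _ | inj₁ r′ = contradiction r′ ¬r
  ... | no _ | no ¬r | inj₂ r′ = contradiction r′ ¬r

  -- Totality applies to equal arguments too, so loops count and N vertices have at least N(N - 1)/2
  -- + N related pairs. In the induction `x` contributes its row and its column.
  length²≤total : ∀ {us} → (∀ {u v} → u ∈ us → v ∈ us → R u v ⊎ R v u) → length us * suc (length us) ≤ 2 * total us us
  length²≤total {[]} _ = z≤n
  length²≤total {x ∷ us} tot = begin
    suc k * suc (suc k) ≡⟨ solve 1 (λ k → (con 1 :+ k) :* (con 2 :+ k) := con 2 :* (con 1 :+ k) :+ k :* (con 1 :+ k)) refl k ⟩
    2 * suc k + k * suc k ≤⟨ +-mono-≤ (*-monoʳ-≤ 2 wins) (length²≤total (λ p q → tot (there p) (there q))) ⟩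
    2 * (score x (x ∷ us) + losses x us) + 2 * total us us ≡⟨ *-distribˡ-+ 2 (score x (x ∷ us) + losses x us) (total us us) ⟨
    2 * (score x (x ∷ us) + losses x us + total us us) ≡⟨ cong (2 *_) (+-assoc (score x (x ∷ us)) (losses x us) (total us us)) ⟩
    2 * (score x (x ∷ us) + (losses x us + total us us)) ≡⟨ cong (λ t → 2 * (score x (x ∷ us) + t)) (total-cons x us us) ⟨
    2 * total (x ∷ us) (x ∷ us) ∎
    where
    open ≤-Reasoning
    open +-*-Solver
    k = length us
    wins : suc k ≤ score x (x ∷ us) + losses x us
    wins with R? x x | tot (here refl) (here refl)
    ... | yes _ | _ = s≤s (score+losses x (All.tabulate λ p → tot (here refl) (there p)))
    ... | no ¬r | inj₁ r = contradiction r ¬r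
    ... | no ¬r | inj₂ r = contradiction r ¬r

  total≤ : ∀ {k us vs} → All (λ u → score u vs ≤ k) us → total us vs ≤ length us * k
  total≤ [] = z≤n
  total≤ {vs = vs} (h ∷ hs) = +-mono-≤ h (total≤ {vs = vs} hs)

  -- Averaging: if no score exceeded `k`, twice the sum of the N scores would be at most N · 2k,
  -- less than the N(N + 1) that totality guarantees.
  high-score : ∀ k {us} → (∀ {u v} → u ∈ us → v ∈ us → R u v ⊎ R v u) → k + k < length us →
    ∃ λ u → u ∈ us × k < score u us
  high-score k {us} tot k+k< with All.all? (λ u → score u us ≤? k) us
  ... | no ¬all with find (All.¬All⇒Any¬ (λ u → score u us ≤? k) us ¬all)
  ... | u , u∈ , s≰ = u , u∈ , ≰⇒> s≰
  high-score k {us} tot k+k< | yes all = contradiction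
    (begin-strict
      length us * (k + k) <⟨ *-monoʳ-< (length us) {{>-nonZero (≤-<-trans z≤n k+k<)}} (m≤n⇒m≤1+n k+k<) ⟩
      length us * suc (length us) ≤⟨ length²≤total tot ⟩
      2 * total us us ≤⟨ *-monoʳ-≤ 2 (total≤ {vs = us} all) ⟩
      2 * (length us * k) ≡⟨ solve 2 (λ m k → con 2 :* (m :* k) := m :* (k :+ k)) refl (length us) k ⟩
      length us * (k + k) ∎)
    (<-irrefl refl)
    where
    open ≤-Reasoning
    open +-*-Solver

least : ∀ {A : Set} {_⊑_ : A → A → Set} → (∀ {x y z} → x ⊑ y → y ⊑ z → x ⊑ z) →
  ∀ {xs} → (∀ {x y} → x ∈ xs → y ∈ xs → x ⊑ y ⊎ y ⊑ x) → 1 ≤ length xs →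
  ∃ λ x → x ∈ xs × All (x ⊑_) xs
least ⊑-trans {x ∷ []} tot _ with tot (here refl) (here refl)
... | inj₁ r = x , here refl , r ∷ []
... | inj₂ r = x , here refl , r ∷ []
least ⊑-trans {x ∷ xs@(_ ∷ _)} tot _ with least ⊑-trans {xs} (λ p q → tot (there p) (there q)) (s≤s z≤n)
... | m , m∈ , h with tot (here refl) (there m∈) | tot (here refl) (here refl)
... | inj₂ m⊑x | _ = m , there m∈ , m⊑x ∷ h
... | inj₁ x⊑m | inj₁ x⊑x = x , here refl , x⊑x ∷ All.map (⊑-trans x⊑m) h
... | inj₁ x⊑m | inj₂ x⊑x = x , here refl , x⊑x ∷ All.map (⊑-trans x⊑m) h

-- Minimal separators around a connected set

module _ (G : Graph n) where

  -- Modelled on a minimal separator `S` with two full components `A` and `B` of G - S: every vertex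
  -- of `S` has neighbours on both sides.
  record Separation : Set₁ where
    field
      A B S : VSet n
      A-connected : Connected G A
      B-connected : Connected G B
      A∩B : ∀ {x} → A ∋ x → ¬ B ∋ x
      B∩S : ∀ {x} → B ∋ x → ¬ S ∋ x
      A-closed : ∀ {x y} → A ∋ x → Adj G x y → A ∋ y ⊎ S ∋ y
      B-closed : ∀ {x y} → B ∋ x → Adj G x y → B ∋ y ⊎ S ∋ y
      A-full : ∀ {s} → S ∋ s → Touches G A s
      B-full : ∀ {s} → S ∋ s → Touches G B s

    anticomplete : ∀ {a b} → A ∋ a → B ∋ b → ¬ Adj G a b
    anticomplete Aa Bb a~b with A-closed Aa a~b
    ... | inj₁ Ab = A∩B Ab Bb
    ... | inj₂ Sb = B∩S Bb Sb

  far? : ∀ C → Decidable (λ y → ¬ C ∋ y × ¬ Touches G C y)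
  far? C y = ¬? (C ∋? y) ×-dec ¬? (touches? G C y)

  record SeparationAround (C : VSet n) (v : Fin n) : Set₁ where
    field
      separation : Separation
    open Separation separation public
    field
      C⊆A : ∀ {x} → C ∋ x → A ∋ x
      S⊆ : ∀ {s} → S ∋ s → Touches G C s
      v∈B : B ∋ v
      B-maximal : ∀ {x y} → B ∋ x → Adj G x y → ¬ C ∋ y → ¬ Touches G C y → B ∋ y

  -- `B` is the component of `v` in G - N[C], `S` is N(B), and `A` is the component of G - S that
  -- contains `C`. By maximality of `B` its boundary lies in N(C), and this makes `A` full.
  separateFrom : ∀ {C u v} → Connected G C → C ∋ u → ¬ C ∋ v → ¬ Touches G C v → SeparationAround C v
  separateFrom {C} {u} {v} C-conn Cu ¬Cv ¬Cv′ = record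
    { separation = record
      { A = A.part ; B = B.part ; S = S
      ; A-connected = A.connected ; B-connected = B.connected
      ; A∩B = A∩B
      ; B∩S = λ Bx Sx → proj₁ (∈⁻ (boundary? G B.part) Sx) Bx
      ; A-closed = λ {x} {y} Ax x~y → A-closed Ax x~y
      ; B-closed = λ {x} {y} Bx x~y → B-closed Bx x~y
      ; A-full = λ Ss → let c , Cc , c~s = S⊆ Ss in c , C⊆A Cc , c~s
      ; B-full = λ Ss → proj₂ (∈⁻ (boundary? G B.part) Ss)
      }
    ; C⊆A = C⊆A ; S⊆ = S⊆ ; v∈B = B.base
    ; B-maximal = λ {x} {y} Bx x~y ¬Cy ¬ty → B.closed Bx (∈⁺ (far? C) (¬Cy , ¬ty)) x~y
    }
    where
    module B = Component (component G ⟪ far? C ⟫ (∈⁺ (far? C) (¬Cv , ¬Cv′)))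
    S : VSet n
    S = ⟪ boundary? G B.part ⟫
    B-far : ∀ {x} → B.part ∋ x → ¬ C ∋ x × ¬ Touches G C x
    B-far Bx = ∈⁻ (far? C) (B.part⊆ Bx)
    S⊆ : ∀ {s} → S ∋ s → Touches G C s
    S⊆ {s} Ss with ∈⁻ (boundary? G B.part) Ss
    ... | ¬Bs , b , Bb , b~s = decidable-stable (touches? G C s) λ ¬t →
      ¬Bs (B.closed Bb (∈⁺ (far? C) ((λ Cs → proj₂ (B-far Bb) (s , Cs , Adj-sym G b~s)) , ¬t)) b~s)
    C∩S : ∀ {x} → C ∋ x → ∁ S ∋ x
    C∩S {x} Cx = ∈∁⁺ S λ Sx → let _ , b , Bb , b~x = ∈⁻ (boundary? G B.part) Sx
      in proj₂ (B-far Bb) (x , Cx , Adj-sym G b~x)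
    module A = Component (component G (∁ S) (C∩S Cu))
    C⊆A : ∀ {x} → C ∋ x → A.part ∋ x
    C⊆A = connected-⊆ G C-conn A.base Cu λ Ax _ Cy x~y → A.closed Ax (C∩S Cy) x~y
    B-closed : ∀ {x y} → B.part ∋ x → Adj G x y → B.part ∋ y ⊎ S ∋ y
    B-closed {x} {y} Bx x~y with B.part ∋? y
    ... | yes By = inj₁ By
    ... | no ¬By = inj₂ (∈⁺ (boundary? G B.part) (¬By , x , Bx , x~y))
    A-closed : ∀ {x y} → A.part ∋ x → Adj G x y → A.part ∋ y ⊎ S ∋ y
    A-closed {x} {y} Ax x~y with S ∋? y
    ... | yes Sy = inj₂ Sy
    ... | no ¬Sy = inj₁ (A.closed Ax (∈∁⁺ S ¬Sy) x~y)
    A∩B : ∀ {x} → A.part ∋ x → ¬ B.part ∋ x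
    -- If `A` met `B`, then cutting `A` by `B` would give an edge of `A` leaving `B`; its end would
    -- lie in N(B), which is `S`.
    A∩B {x} Ax Bx with A.connected (B.part ∋?_) Ax Bx A.base (λ Bu → proj₁ (B-far Bu) Cu)
    ... | y , z , _ , By , Az , ¬Bz , y~z =
      ∈∁⁻ S (A.part⊆ Az) (∈⁺ (boundary? G B.part) (¬Bz , y , By , y~z))

  record SmallSeparation (k : ℕ) (P : VSet n) : Set₁ where
    field
      separation : Separation
    open Separation separation public
    field
      {u v} : Fin n
      u∈A : A ∋ u
      u∈P : P ∋ u
      v∈B : B ∋ v
      v∈P : P ∋ v
      S-small : α≤ G (S ∋_) k

  -- Splitting a set of large independence number

  module _ {ℓ} (P5-free : Free P5 G) (K-free : Free (K ℓ) G) (1≤ℓ : 1 ≤ ℓ) where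

    private
      infix 4 _~_ _~?_ _∈?_
      _~_ = Adj G
      _~?_ = Adj? G
      _∈?_ = DecMembership._∈?_ (_≟_ {n})
      ~-sym : ∀ {u v} → u ~ v → v ~ u
      ~-sym = Adj-sym G

    noBiclique : ∀ {xs ys} → Indep G xs → Indep G ys → ℓ ≤ length xs → ℓ ≤ length ys →
      (∀ {x y} → x ∈ xs → y ∈ ys → x ~ y) → ⊥
    noBiclique ix iy ℓ≤x ℓ≤y c = K-free (inducedBiclique G ℓ ix iy ℓ≤x ℓ≤y c)

    α-complete≤ : ∀ {I} → Indep G I → ℓ ≤ length I → α≤ G (λ s → All (s ~_) I) ℓ
    α-complete≤ iI ℓ≤I {xs} ix h = ≮⇒≥ λ ℓ<xs →
      noBiclique ix iI (<⇒≤ ℓ<xs) ℓ≤I (λ p q → All.lookup (All.lookup h p) q)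

    -- Separation around the singleton of `u` puts the separator inside N(u).
    separate-lowDegree : ∀ {P u v} → P ∋ u → P ∋ v → u ≢ v → ¬ u ~ v →
      α≤ G (u ~_) (ℓ + ℓ) → SmallSeparation (ℓ + ℓ) P
    separate-lowDegree {P} {u} {v} Pu Pv u≢v ¬u~v low = record
      { separation = separation ; u∈A = C⊆A Cu ; u∈P = Pu ; v∈B = v∈B ; v∈P = Pv
      ; S-small = α≤-mono G (λ Ss → nbr (S⊆ Ss)) low }
      where
      C = ⟪ _≟ u ⟫
      Cu : C ∋ u
      Cu = ∈⁺ (_≟ u) refl
      nbr : ∀ {s} → Touches G C s → u ~ s
      nbr {s} (c , Cc , c~s) = subst (_~ s) (∈⁻ (_≟ u) Cc) c~s
      open SeparationAround (separateFrom {C} (star-connected G Cu λ {a} Ca → inj₁ (∈⁻ (_≟ u) Ca)) Cu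
        (λ Cv → u≢v (≡-sym (∈⁻ (_≟ u) Cv))) (¬u~v ∘ nbr))

    star? : ∀ u I → Decidable (λ x → x ≡ u ⊎ x ∈ I)
    star? u I x = x ≟ u ⊎-dec x ∈? I

    -- Separation around the star at `u` leaves the star at `v` inside `B`. Each vertex of `S` is
    -- then complete to `I` or to `J`, and each of the two kinds has independence number at most
    -- `ℓ`.
    separate-stars : ∀ {P u v I J} → P ∋ u → P ∋ v → u ≢ v → ¬ u ~ v →
      Indep G I → Indep G J → ℓ ≤ length I → ℓ ≤ length J →
      All (u ~_) I → All (λ i → ¬ v ~ i) I → All (v ~_) J → All (λ j → ¬ u ~ j) J →
      (∀ {i j} → i ∈ I → j ∈ J → ¬ i ~ j) → SmallSeparation (ℓ + ℓ) P
    separate-stars {P} {u} {v} {I} {J} Pu Pv u≢v ¬u~v iI iJ ℓ≤I ℓ≤J u~I ¬v~I v~J ¬u~J ¬I~J = record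
      { separation = separation ; u∈A = C⊆A Cu ; u∈P = Pu ; v∈B = v∈B ; v∈P = Pv
      ; S-small = α≤-∪ G (λ s → All.all? (s ~?_) I) one (α-complete≤ iI ℓ≤I) (α-complete≤ iJ ℓ≤J) }
      where
      C = ⟪ star? u I ⟫
      R = ⟪ star? v J ⟫
      Cu : C ∋ u
      Cu = ∈⁺ (star? u I) (inj₁ refl)
      Rv : R ∋ v
      Rv = ∈⁺ (star? v J) (inj₁ refl)
      star-conn : ∀ {u I} → All (u ~_) I → Connected G ⟪ star? u I ⟫
      star-conn {u} {I} u~I = star-connected G (∈⁺ (star? u I) (inj₁ refl))
        λ {a} e → [ inj₁ , (λ p → inj₂ (All.lookup u~I p)) ]′ (∈⁻ (star? u I) e)
      R-far : ∀ {x} → R ∋ x → ¬ C ∋ x × ¬ Touches G C x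
      R-far {x} Rx = (λ Cx → disjoint (∈⁻ (star? u I) Cx) (∈⁻ (star? v J) Rx)) ,
        λ (c , Cc , c~x) → anti (∈⁻ (star? u I) Cc) (∈⁻ (star? v J) Rx) c~x
        where
        disjoint : ∀ {x} → x ≡ u ⊎ x ∈ I → x ≡ v ⊎ x ∈ J → ⊥
        disjoint (inj₁ refl) (inj₁ refl) = u≢v refl
        disjoint (inj₁ refl) (inj₂ q) = ¬u~v (~-sym (All.lookup v~J q))
        disjoint (inj₂ p) (inj₁ refl) = ¬u~v (All.lookup u~I p)
        disjoint (inj₂ p) (inj₂ q) = All.lookup ¬v~I p (All.lookup v~J q)
        anti : ∀ {c x} → c ≡ u ⊎ c ∈ I → x ≡ v ⊎ x ∈ J → ¬ c ~ x
        anti (inj₁ refl) (inj₁ refl) = ¬u~v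
        anti (inj₁ refl) (inj₂ q) = All.lookup ¬u~J q
        anti (inj₂ p) (inj₁ refl) = All.lookup ¬v~I p ∘ ~-sym
        anti (inj₂ p) (inj₂ q) = ¬I~J p q
      open SeparationAround (separateFrom {C} (star-conn u~I) Cu (proj₁ (R-far Rv)) (proj₂ (R-far Rv)))
      -- The second star avoids N[C], so maximality of `B` carries membership from `v` to all of it.
      R⊆B : ∀ {x} → R ∋ x → B ∋ x
      R⊆B = connected-⊆ G (star-conn v~J) v∈B Rv
        λ Bx _ Ry x~y → B-maximal Bx x~y (proj₁ (R-far Ry)) (proj₂ (R-far Ry))
      one : ∀ {s} → S ∋ s → All (s ~_) I ⊎ All (s ~_) J
      one Ss with complete-to-one G P5-free A-connected B-connected anticomplete (A-full Ss) (B-full Ss)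
      ... | inj₁ s~A = inj₁ (All.tabulate λ {i} p → s~A (C⊆A (∈⁺ (star? u I) (inj₂ p))))
      ... | inj₂ s~B = inj₂ (All.tabulate λ {j} q → s~B (R⊆B (∈⁺ (star? v J) (inj₂ q))))

    -- Otherwise `v j i u i′` is an induced P₅.
    all-or-nothing : ∀ {u v I} → Indep G I → ¬ u ~ v → All (u ~_) I → All (λ i → ¬ v ~ i) I →
      ∀ {j} → v ~ j → ¬ u ~ j → ∀ {i i′} → i ∈ I → i′ ∈ I → i ~ j → i′ ~ j
    all-or-nothing iI ¬u~v u~I ¬v~I {j} v~j ¬u~j {i} {i′} p p′ i~j =
      decidable-stable (i′ ~? j) λ ¬i′~j → P5-free
        (inducedP5 G v~j (~-sym i~j) (~-sym (All.lookup u~I p)) (All.lookup u~I p′)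
          (All.lookup ¬v~I p) (¬u~v ∘ ~-sym) (All.lookup ¬v~I p′)
          (¬u~j ∘ ~-sym) (¬i′~j ∘ ~-sym) (nonAdj iI p p′))

    separate-incomparable : ∀ {P u v I J} → P ∋ u → P ∋ v → u ≢ v → ¬ u ~ v →
      Indep G I → Indep G J → ℓ ≤ length I → ℓ ≤ length J →
      All (u ~_) I → All (λ i → ¬ v ~ i) I → All (v ~_) J → All (λ j → ¬ u ~ j) J → SmallSeparation (ℓ + ℓ) P
    separate-incomparable {I = I} {J} Pu Pv u≢v ¬u~v iI iJ ℓ≤I ℓ≤J u~I ¬v~I v~J ¬u~J
      with any? (λ i → i ∈? I ×-dec any? λ j → j ∈? J ×-dec i ~? j)
    ... | no none = separate-stars Pu Pv u≢v ¬u~v iI iJ ℓ≤I ℓ≤J u~I ¬v~I v~J ¬u~J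
      λ {i} {j} p q i~j → none (i , p , j , q , i~j)
    -- A single edge between `I` and `J` spreads: first from `j` to every `j′` with `i` fixed, then
    -- from `i` to every `i′`. The result is a biclique.
    ... | yes (i , p , j , q , i~j) = ⊥-elim (noBiclique iI iJ ℓ≤I ℓ≤J λ p′ q′ →
      all-or-nothing iI ¬u~v u~I ¬v~I (All.lookup v~J q′) (All.lookup ¬u~J q′) p p′
        (~-sym (all-or-nothing iJ (¬u~v ∘ ~-sym) v~J ¬u~J (All.lookup u~I p) (All.lookup ¬v~I p) q q′ (~-sym i~j))))

    -- The traces of `J` on `I` are nested: if `v` alone sees `i` and `w` alone sees `j`, then
    -- `v i u j w` is an induced P₅. The least trace has at least `ℓ` vertices and is complete to
    -- `J`.
    no-common-star : ∀ {u I J} → Indep G I → All (u ~_) I →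
      Indep G J → (∀ {v} → v ∈ J → ¬ u ~ v) → ℓ ≤ length J →
      (∀ {v} → v ∈ J → ℓ ≤ length (filter (v ~?_) I)) → ⊥
    no-common-star {u} {I} {J} iI u~I iJ ¬u~J ℓ≤J many with least ⊑-trans nested (≤-trans 1≤ℓ ℓ≤J)
      where
      _⊑_ : Fin n → Fin n → Set
      v ⊑ w = All (λ i → v ~ i → w ~ i) I
      ⊑-trans : ∀ {x y z} → x ⊑ y → y ⊑ z → x ⊑ z
      ⊑-trans h h′ = All.zipWith (λ (f , g) → g ∘ f) (h , h′)
      nested : ∀ {v w} → v ∈ J → w ∈ J → v ⊑ w ⊎ w ⊑ v
      nested {v} {w} p q with any? (λ i → i ∈? I ×-dec v ~? i ×-dec ¬? (w ~? i))
                            | any? (λ i → i ∈? I ×-dec w ~? i ×-dec ¬? (v ~? i))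
      ... | no h | _ = inj₁ (All.tabulate λ {i} i∈ v~i → decidable-stable (w ~? i) λ ¬w~i → h (i , i∈ , v~i , ¬w~i))
      ... | yes _ | no h = inj₂ (All.tabulate λ {i} i∈ w~i → decidable-stable (v ~? i) λ ¬v~i → h (i , i∈ , w~i , ¬v~i))
      ... | yes (i , i∈ , v~i , ¬w~i) | yes (j , j∈ , w~j , ¬v~j) = contradiction
        (inducedP5 G v~i (~-sym (All.lookup u~I i∈)) (All.lookup u~I j∈) (~-sym w~j)
          (¬u~J p ∘ ~-sym) ¬v~j (nonAdj iJ p q) (nonAdj iI i∈ j∈) (¬w~i ∘ ~-sym) (¬u~J q)) P5-free
    ... | v , v∈ , least-v = noBiclique iJ (indep-filter G (v ~?_) iI) ℓ≤J (many v∈) λ w∈ i∈ →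
      let i∈I , v~i = ∈-filter⁻ (v ~?_) i∈ in All.lookup (All.lookup least-v w∈) i∈I v~i

    HighDegree : Fin n → Set
    HighDegree u = HasIndep G (u ~_) (suc (ℓ + ℓ))

    highDegree? : Decidable HighDegree
    highDegree? u = hasIndep? G (u ~?_) (suc (ℓ + ℓ))

    -- Fixes one set I_u per vertex, so that the lists `privateNbrs u v` for varying `v` are cut
    -- from the same set.
    nbrs : Fin n → List (Fin n)
    nbrs u with highDegree? u
    ... | yes (xs , _) = xs
    ... | no _ = []

    nbrs-spec : ∀ {u} → HighDegree u → Indep G (nbrs u) × All (u ~_) (nbrs u) × ℓ + ℓ < length (nbrs u)
    nbrs-spec {u} h with highDegree? u
    ... | yes (_ , spec) = spec
    ... | no ¬h = contradiction h ¬h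

    privateNbrs : Fin n → Fin n → List (Fin n)
    privateNbrs u v = filter (¬? ∘ (v ~?_)) (nbrs u)

    private-spec : ∀ {u v} → HighDegree u →
      Indep G (privateNbrs u v) × All (u ~_) (privateNbrs u v) × All (λ i → ¬ v ~ i) (privateNbrs u v)
    private-spec {u} {v} h = let i , u~ , _ = nbrs-spec h in
      indep-filter G (¬? ∘ (v ~?_)) i , All.filter⁺ (¬? ∘ (v ~?_)) u~ , All.all-filter (¬? ∘ (v ~?_)) (nbrs u)

    -- All of I_u lies in N(u), so `privateNbrs u u` is empty and cannot have `ℓ` ≥ 1 elements.
    private-self : ∀ {u v} → HighDegree u → ℓ ≤ length (privateNbrs u v) → u ≢ v
    private-self {u} h ℓ≤ refl with privateNbrs u u | private-spec {u} {u} h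
    ... | [] | _ with () ← ≤-trans 1≤ℓ ℓ≤
    private-self h ℓ≤ refl | _ ∷ _ | _ , u~ ∷ _ , ¬u~ ∷ _ = ¬u~ u~

    -- I_u has more than 2ℓ vertices and fewer than `ℓ` of them lie outside N(v).
    common-nbrs : ∀ {u v} → HighDegree u → length (privateNbrs u v) < ℓ → ℓ ≤ length (filter (v ~?_) (nbrs u))
    common-nbrs {u} {v} h few = ≮⇒≥ λ lt → <-asym (proj₂ (proj₂ (nbrs-spec h)))
      (subst (_< ℓ + ℓ) (≡-sym (filter-split (v ~?_) (nbrs u))) (+-mono-< lt few))

    separate-highDegree : ∀ {P J} → Indep G J → All (P ∋_) J → ℓ + ℓ < length J → All HighDegree J →
      SmallSeparation (ℓ + ℓ) P
    separate-highDegree {P} {J} iJ J⊆P 2ℓ<J high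
      with any? (λ u → any? λ v → u ∈? J ×-dec v ∈? J ×-dec
             ℓ ≤? length (privateNbrs u v) ×-dec ℓ ≤? length (privateNbrs v u))
    ... | yes (u , v , u∈ , v∈ , large-u , large-v) =
      let hu = All.lookup high u∈ ; hv = All.lookup high v∈
          iI , u~I , ¬v~I = private-spec hu ; iJ′ , v~J , ¬u~J = private-spec hv
      in separate-incomparable (All.lookup J⊆P u∈) (All.lookup J⊆P v∈) (private-self hu large-u)
           (nonAdj iJ u∈ v∈) iI iJ′ large-u large-v u~I ¬v~I v~J ¬u~J
    -- The vertices beaten by `u` include `u` itself, because I_u - N(u) is empty. This does no
    -- harm: `u` is not adjacent to itself and sees all of I_u.
    ... | no comparable =
      let u , u∈ , ℓ<score = high-score ℓ dominated 2ℓ<J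
          iI , u~I , _ = nbrs-spec (All.lookup high u∈)
      in ⊥-elim (no-common-star iI u~I (indep-filter G (R? u) iJ)
        (λ v∈ → nonAdj iJ u∈ (proj₁ (∈-filter⁻ (R? u) v∈))) (<⇒≤ ℓ<score)
        (λ v∈ → common-nbrs (All.lookup high u∈) (proj₂ (∈-filter⁻ (R? u) {xs = J} v∈))))
      where
      R? : ∀ u v → Dec (length (privateNbrs u v) < ℓ)
      R? u v = length (privateNbrs u v) <? ℓ
      open Tournament R?
      dominated : ∀ {u v} → u ∈ J → v ∈ J → length (privateNbrs u v) < ℓ ⊎ length (privateNbrs v u) < ℓ
      dominated {u} {v} u∈ v∈ with R? u v | R? v u
      ... | yes r | _ = inj₁ r
      ... | no _ | yes r = inj₂ r
      ... | no ¬r | no ¬r′ = contradiction (u , v , u∈ , v∈ , ≮⇒≥ ¬r , ≮⇒≥ ¬r′) comparable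

    another : ∀ {J} u → Indep G J → 2 ≤ length J → ∃ λ v → v ∈ J × u ≢ v
    another {a ∷ b ∷ _} u iJ _ with u ≟ a | unique iJ
    ... | no u≢a | _ = a , here refl , u≢a
    ... | yes refl | (a≢b ∷ _) ∷ _ = b , there (here refl) , a≢b
    another {_ ∷ []} _ _ (s≤s ())

    separate : ∀ {P J} → Indep G J → All (P ∋_) J → ℓ + ℓ < length J → SmallSeparation (ℓ + ℓ) P
    separate {P} {J} iJ J⊆P 2ℓ<J with All.all? highDegree? J
    ... | yes high = separate-highDegree iJ J⊆P 2ℓ<J high
    ... | no ¬high with find (All.¬All⇒Any¬ highDegree? J ¬high)
    -- Since 2ℓ ≥ 2, `J` has a second vertex, and independence puts it outside N[u].
    ... | u , u∈ , ¬large with another u iJ (≤-trans (+-mono-≤ 1≤ℓ 1≤ℓ) (<⇒≤ 2ℓ<J))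
    ... | v , v∈ , u≢v = separate-lowDegree (All.lookup J⊆P u∈) (All.lookup J⊆P v∈) u≢v (nonAdj iJ u∈ v∈)
      λ {xs} i h → ≮⇒≥ λ lt → ¬large (xs , i , h , lt)

-- Growing the decomposition

module _ {n} (G : Graph n) (ℓ : ℕ) where

  private
    infix 4 _~_
    _~_ = Adj G

  -- The fields say that `P` is a component of G - U. Stated as a property, it lets a region of a
  -- larger set be recognised as a region of `U`.
  record Region (U P : VSet n) : Set₁ where
    field
      {base} : Fin n
      nonempty : P ∋ base
      connected : Connected G P
      disjoint : ∀ {v} → P ∋ v → ¬ U ∋ v
      boundary⊆ : ∀ {v} → Boundary G P v → U ∋ v

    leave : ∀ {x y} → P ∋ x → x ~ y → P ∋ y ⊎ U ∋ y
    leave {x} {y} Px x~y with P ∋? y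
    ... | yes Py = inj₁ Py
    ... | no ¬Py = inj₂ (boundary⊆ (¬Py , x , Px , x~y))

  record Safe (P : VSet n) : Set where
    field
      boundary-small : α≤ G (Boundary G P) (ℓ + ℓ)
      outside : ∀ {w} → Boundary G P w → ∃ λ c → c ~ w × ¬ P ∋ c × ¬ Touches G P c

  -- A tree-decomposition of G[U], ready to be continued into the components of G − U.
  record Partial (U : VSet n) : Set₁ where
    field
      {nodes} : ℕ
      T : Graph (suc nodes)
      isTree : IsTree T
      bag : Fin (suc nodes) → VSet n
      bag⊆ : ∀ {t v} → bag t ∋ v → U ∋ v
      covers : ∀ {v} → U ∋ v → ∃ λ t → bag t ∋ v
      subtree : ∀ v → InducesConnected T (λ t → bag t ∋ v)
      edge : ∀ {u v} → U ∋ u → U ∋ v → u ~ v → ∃ λ t → bag t ∋ u × bag t ∋ v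
      width : ∀ t → α≤ G (bag t ∋_) ((ℓ + ℓ) + (ℓ + ℓ))
      safe : ∀ {P} → Region U P → Safe P
      anchor : ∀ {P} → Region U P → ∃ λ t → ∀ {v} → Boundary G P v → bag t ∋ v

  ∪? : ∀ (U X : VSet n) → Decidable (λ v → U ∋ v ⊎ X ∋ v)
  ∪? U X v = U ∋? v ⊎-dec X ∋? v

  _∪_ : VSet n → VSet n → VSet n
  U ∪ X = ⟪ ∪? U X ⟫

  empty : VSet n
  empty _ = false

  -- A region of the empty set has empty boundary, so the invariant holds vacuously and the only
  -- node anchors every region.
  empty-partial : Partial empty
  empty-partial = record
    { T = point ; isTree = point-isTree ; bag = λ _ → empty ; bag⊆ = λ () ; covers = λ ()
    ; subtree = λ _ → point-connected ; edge = λ () ; width = λ { _ {[]} _ _ → z≤n ; _ {_ ∷ _} _ (() ∷ _) }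
    ; safe = λ R → record
      { boundary-small = λ { {[]} _ _ → z≤n ; {_ ∷ _} _ (b ∷ _) → none R b }
      ; outside = λ b → none R b }
    ; anchor = λ R → fz , λ b → none R b
    }
    where
    none : ∀ {P v} {A : Set} → Region empty P → Boundary G P v → A
    none R b with () ← Region.boundary⊆ R b

  -- The new leaf has bag N(P) ∪ X and hangs from the anchor of `P`, whose bag contains N(P). A
  -- region of `U ∪ X` either lies inside `P` or is already a region of `U`, so safety is demanded
  -- only for the former.
  extend : ∀ {U P} X → Partial U → Region U P → (∀ {v} → X ∋ v → P ∋ v) →
    α≤ G (X ∋_) (ℓ + ℓ) →
    (∀ {P′} → Region (U ∪ X) P′ → (∀ {v} → P′ ∋ v → P ∋ v) → Safe P′) → Partial (U ∪ X)
  extend {U} {P} X D R X⊆P αX new-safe = record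
    { T = attach D.T t ; isTree = attach-isTree D.isTree ; bag = bag′
    ; bag⊆ = λ {s} → bag′⊆ s ; covers = λ e → covers′ (∈⁻ (∪? U X) e)
    ; subtree = λ v → attach-connected (D.subtree v) λ e → leaf (∈⁻ new? e)
    ; edge = λ eu ev → edge′ (∈⁻ (∪? U X) eu) (∈⁻ (∪? U X) ev)
    ; width = width′ ; safe = λ R′ → safe′ R′ (meets? R′) ; anchor = λ R′ → anchor′ R′ (meets? R′) }
    where
    module D = Partial D
    module R = Region R
    t = proj₁ (D.anchor R)
    new? : Decidable (λ v → Boundary G P v ⊎ X ∋ v)
    new? v = boundary? G P v ⊎-dec X ∋? v
    bag′ : Fin (suc (suc D.nodes)) → VSet n
    bag′ fz = ⟪ new? ⟫
    bag′ (fs s) = D.bag s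
    bag′⊆ : ∀ s {v} → bag′ s ∋ v → (U ∪ X) ∋ v
    bag′⊆ fz e = ∈⁺ (∪? U X) ([ inj₁ ∘ R.boundary⊆ , inj₂ ]′ (∈⁻ new? e))
    bag′⊆ (fs s) e = ∈⁺ (∪? U X) (inj₁ (D.bag⊆ e))
    covers′ : ∀ {v} → U ∋ v ⊎ X ∋ v → ∃ λ s → bag′ s ∋ v
    covers′ (inj₁ Uv) = let s , e = D.covers Uv in fs s , e
    covers′ (inj₂ Xv) = fz , ∈⁺ new? (inj₂ Xv)
    leaf : ∀ {v} → Boundary G P v ⊎ X ∋ v → D.bag t ∋ v ⊎ (∀ s → ¬ D.bag s ∋ v)
    leaf (inj₁ b) = inj₁ (proj₂ (D.anchor R) b)
    leaf (inj₂ Xv) = inj₂ λ s e → R.disjoint (X⊆P Xv) (D.bag⊆ e)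
    X~U→boundary : ∀ {u v} → X ∋ u → U ∋ v → u ~ v → Boundary G P v
    X~U→boundary Xu Uv u~v = (λ Pv → R.disjoint Pv Uv) , _ , X⊆P Xu , u~v
    edge′ : ∀ {u v} → U ∋ u ⊎ X ∋ u → U ∋ v ⊎ X ∋ v → u ~ v → ∃ λ s → bag′ s ∋ u × bag′ s ∋ v
    edge′ (inj₁ Uu) (inj₁ Uv) u~v = let s , e = D.edge Uu Uv u~v in fs s , e
    edge′ (inj₁ Uu) (inj₂ Xv) u~v = fz , ∈⁺ new? (inj₁ (X~U→boundary Xv Uu (Adj-sym G u~v))) , ∈⁺ new? (inj₂ Xv)
    edge′ (inj₂ Xu) (inj₁ Uv) u~v = fz , ∈⁺ new? (inj₂ Xu) , ∈⁺ new? (inj₁ (X~U→boundary Xu Uv u~v))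
    edge′ (inj₂ Xu) (inj₂ Xv) u~v = fz , ∈⁺ new? (inj₂ Xu) , ∈⁺ new? (inj₂ Xv)
    width′ : ∀ s → α≤ G (bag′ s ∋_) ((ℓ + ℓ) + (ℓ + ℓ))
    width′ fz = α≤-∪ G (boundary? G P) (∈⁻ new?) (Safe.boundary-small (D.safe R)) αX
    width′ (fs s) = D.width s
    meets? : ∀ {P′} → Region (U ∪ X) P′ → Dec (∃ λ v → P′ ∋ v × P ∋ v)
    meets? {P′} _ = any? λ v → P′ ∋? v ×-dec P ∋? v
    module _ {P′} (R′ : Region (U ∪ X) P′) where
      module R′ = Region R′
      stay : ∀ {x y} → P ∋ x → P′ ∋ y → x ~ y → P ∋ y
      stay Px P′y x~y with R.leave Px x~y
      ... | inj₁ Py = Py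
      ... | inj₂ Uy = contradiction (∈⁺ (∪? U X) (inj₁ Uy)) (R′.disjoint P′y)
      inside : ∃ (λ v → P′ ∋ v × P ∋ v) → ∀ {v} → P′ ∋ v → P ∋ v
      inside (v , P′v , Pv) = connected-⊆ G R′.connected Pv P′v λ Px _ P′y x~y → stay Px P′y x~y
      -- A region apart from `P` has no neighbour in `X`: such a neighbour lies in `P`, and an edge
      -- leaving `P` ends in `U`.
      old : ¬ ∃ (λ v → P′ ∋ v × P ∋ v) → Region U P′
      old apart = record
        { nonempty = R′.nonempty ; connected = R′.connected
        ; disjoint = λ P′v Uv → R′.disjoint P′v (∈⁺ (∪? U X) (inj₁ Uv))
        ; boundary⊆ = λ b → old-boundary b (∈⁻ (∪? U X) (R′.boundary⊆ b)) }
        where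
        old-boundary : ∀ {v} → Boundary G P′ v → U ∋ v ⊎ X ∋ v → U ∋ v
        old-boundary _ (inj₁ Uv) = Uv
        old-boundary (_ , a , P′a , a~v) (inj₂ Xv) =
          contradiction (a , P′a , stay (X⊆P Xv) P′a (Adj-sym G a~v)) apart
      safe′ : Dec (∃ λ v → P′ ∋ v × P ∋ v) → Safe P′
      safe′ (yes m) = new-safe R′ (inside m)
      safe′ (no ¬m) = D.safe (old ¬m)
      anchor′ : Dec (∃ λ v → P′ ∋ v × P ∋ v) → ∃ λ s → ∀ {v} → Boundary G P′ v → bag′ s ∋ v
      anchor′ (no ¬m) = let s , h = D.anchor (old ¬m) in fs s , h
      -- The boundary of a region inside `P` lies in N(P) ∪ X, so the new leaf anchors it.
      anchor′ (yes m) = fz , λ b → ∈⁺ new? (new-boundary b (∈⁻ (∪? U X) (R′.boundary⊆ b)))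
        where
        new-boundary : ∀ {v} → Boundary G P′ v → U ∋ v ⊎ X ∋ v → Boundary G P v ⊎ X ∋ v
        new-boundary (_ , a , P′a , a~v) (inj₁ Uv) = inj₁ ((λ Pv → R.disjoint Pv Uv) , a , inside m P′a , a~v)
        new-boundary _ (inj₂ Xv) = inj₂ Xv

  -- `D` is whichever of `A` and `B` misses `P′`; it supplies neighbours of separator vertices that
  -- are far from `P′`.
  record Side (P S P′ : VSet n) : Set where
    field
      D : VSet n
      closed : ∀ {x y} → D ∋ x → x ~ y → D ∋ y ⊎ S ∋ y
      full : ∀ {s} → S ∋ s → Touches G D s
      avoids : ∀ {x} → P′ ∋ x → ¬ D ∋ x

  module _ (P5-free : Free P5 G) (K-free : Free (K ℓ) G) (1≤ℓ : 1 ≤ ℓ) where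

    -- Safety of the pieces left by a separator

    module _ {U P} (R : Region U P) (safeP : Safe P) (sep : SmallSeparation G (ℓ + ℓ) P) where
      private
        module R = Region R
      open SmallSeparation sep
      open Safe safeP

      cut? : Decidable (λ v → S ∋ v × P ∋ v)
      cut? v = S ∋? v ×-dec P ∋? v

      cut : VSet n
      cut = ⟪ cut? ⟫

      -- `P` joins `u` in `A` to `v` in `B`, so some edge of `P` leaves `A` and ends in `S`. Hence
      -- the extension makes progress.
      cut-nonempty : ∃ λ v → cut ∋ v
      cut-nonempty with R.connected (A ∋?_) u∈P u∈A v∈P (λ v∈A → A∩B v∈A v∈B)
      ... | x , y , Px , Ax , Py , ¬Ay , x~y with A-closed Ax x~y
      ... | inj₁ Ay = contradiction Ay ¬Ay
      ... | inj₂ Sy = y , ∈⁺ cut? (Sy , Py)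

      -- A vertex complete to `A` or to `B` sees `u` or `v`, and both lie in `P`.
      separator-touches : ∀ {s} → S ∋ s → Touches G P s
      separator-touches Ss with complete-to-one G P5-free A-connected B-connected anticomplete (A-full Ss) (B-full Ss)
      ... | inj₁ s~A = u , u∈P , Adj-sym G (s~A u∈A)
      ... | inj₂ s~B = v , v∈P , Adj-sym G (s~B v∈B)

      module _ {P′} (R′ : Region (U ∪ cut) P′) (P′⊆P : ∀ {v} → P′ ∋ v → P ∋ v) where
        private
          module R′ = Region R′

        P′∩S : ∀ {x} → P′ ∋ x → ¬ S ∋ x
        P′∩S P′x Sx = R′.disjoint P′x (∈⁺ (∪? U cut) (inj₂ (∈⁺ cut? (Sx , P′⊆P P′x))))

        -- `P′` is connected and avoids `S`, so if it meets `A` it stays in `A` and misses `B`.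
        side : Side P S P′
        side with any? (λ x → P′ ∋? x ×-dec A ∋? x)
        ... | no avoids = record { D = A ; closed = A-closed ; full = A-full ; avoids = λ P′x Ax → avoids (_ , P′x , Ax) }
        ... | yes (x , P′x , Ax) = record { D = B ; closed = B-closed ; full = B-full
          ; avoids = λ P′y → A∩B (connected-⊆ G R′.connected Ax P′x
              (λ Ay _ P′z y~z → [ (λ Az → Az) , (λ Sz → contradiction Sz (P′∩S P′z)) ]′ (A-closed Ay y~z)) P′y) }

        open Side side

        D-far : ∀ {a r} → P′ ∋ a → D ∋ r → ¬ r ~ a
        D-far P′a Dr r~a = [ avoids P′a , P′∩S P′a ]′ (closed Dr r~a)

        boundary-cases : ∀ {w} → Boundary G P′ w → Boundary G P w ⊎ cut ∋ w
        boundary-cases b@(_ , a , P′a , a~w) with ∈⁻ (∪? U cut) (R′.boundary⊆ b)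
        ... | inj₁ Uw = inj₁ ((λ Pw → R.disjoint Pw Uw) , a , P′⊆P P′a , a~w)
        ... | inj₂ Xw = inj₂ Xw

        -- A vertex of N(P) keeps its witness, since `P′` is inside `P`; a vertex of `cut` takes a
        -- neighbour in `D`.
        outside′ : ∀ {w} → Boundary G P′ w → ∃ λ c → c ~ w × ¬ P′ ∋ c × ¬ Touches G P′ c
        outside′ b with boundary-cases b
        ... | inj₁ b′ = let c , c~w , ¬Pc , ¬tc = outside b′
          in c , c~w , ¬Pc ∘ P′⊆P , λ (a , P′a , a~c) → ¬tc (a , P′⊆P P′a , a~c)
        ... | inj₂ Xw = let r , Dr , r~w = full (proj₁ (∈⁻ cut? Xw))
          in r , r~w , (λ P′r → avoids P′r Dr) , λ (a , P′a , a~r) → D-far P′a Dr (Adj-sym G a~r)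

        -- `bridge` through `P′`, with `c` a neighbour of `w` outside N[P] and `r` a neighbour of
        -- `x` in `D`. Nothing in `D` sees `P′`; nothing in `D` sees `w` either, since `w` is not in
        -- `S` and its neighbour in `P′` keeps it out of `D`.
        no-mixed : ∀ {w x} → Boundary G P′ w → ¬ S ∋ w → Boundary G P′ x → cut ∋ x → ¬ w ~ x → ⊥
        no-mixed {w} {x} bw@(_ , tw@(a , P′a , a~w)) ¬Sw (_ , tx) Xx ¬w~x with boundary-cases bw
        ... | inj₂ Xw = ¬Sw (proj₁ (∈⁻ cut? Xw))
        ... | inj₁ bw′ =
          let Sx , Px = ∈⁻ cut? Xx
              c , c~w , ¬Pc , ¬tc = outside bw′
              r , Dr , r~x = full Sx
              ¬Dw = λ Dw → D-far P′a Dw (Adj-sym G a~w)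
              ¬D~w = λ {d} (Dd : D ∋ d) d~w → [ ¬Dw , ¬Sw ]′ (closed Dd d~w)
          in bridge G P5-free R′.connected tw tx ¬w~x c~w
            (λ P′b c~b → ¬tc (_ , P′⊆P P′b , Adj-sym G c~b)) (λ c~x → ¬tc (x , Px , Adj-sym G c~x))
            r~x (λ P′b b~r → D-far P′b Dr (Adj-sym G b~r)) (¬D~w Dr ∘ Adj-sym G)
            -- If `c` saw `r`, it would lie in `D`, which does not see `w`, or in `S`, all of whose
            -- vertices touch `P`.
            λ c~r → [ (λ Dc → ¬D~w Dc c~w) , (λ Sc → ¬tc (separator-touches Sc)) ]′ (closed Dr (Adj-sym G c~r))

        safe-part : Safe P′
        safe-part = record { outside = outside′ ; boundary-small = small }
          where
          small : α≤ G (Boundary G P′) (ℓ + ℓ)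
          -- Either `xs` lies in `S`, or it avoids `cut` and so lies in N(P), or it has a member
          -- outside `S` and one in `cut`, which `no-mixed` excludes.
          small {xs} i h with All.all? (S ∋?_) xs | All.all? (λ x → ¬? (cut ∋? x)) xs
          ... | yes ⊆S | _ = S-small i ⊆S
          ... | no _ | yes avoid = boundary-small i (All.zipWith
            (λ (b , ¬X) → [ (λ b′ → b′) , (λ Xw → contradiction Xw ¬X) ]′ (boundary-cases b)) (h , avoid))
          ... | no ¬⊆S | no ¬avoid with find (All.¬All⇒Any¬ (S ∋?_) xs ¬⊆S)
                                      | find (All.¬All⇒Any¬ (λ x → ¬? (cut ∋? x)) xs ¬avoid)
          ... | w , w∈ , ¬Sw | x , x∈ , ¬¬Xx = ⊥-elim (no-mixed (All.lookup h w∈) ¬Sw (All.lookup h x∈)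
            (decidable-stable (cut ∋? x) ¬¬Xx) (nonAdj i w∈ x∈))

    enlarge : ∀ {U p} → Partial U → ¬ U ∋ p → Σ (VSet n) λ X → (∃ λ x → X ∋ x × ¬ U ∋ x) × Partial (U ∪ X)
    enlarge {U} {p} D ¬Up = go (α≤-or-large G (C.part ∋?_) (ℓ + ℓ))
      where
      module C = Component (component G (∁ U) (∈∁⁺ U ¬Up))
      R : Region U C.part
      R = record
        { nonempty = C.base ; connected = C.connected ; disjoint = λ e → ∈∁⁻ U (C.part⊆ e)
        ; boundary⊆ = λ {v} (¬Cv , a , Ca , a~v) →
            decidable-stable (U ∋? v) λ ¬Uv → ¬Cv (C.closed Ca (∈∁⁺ U ¬Uv) a~v) }
      go : α≤ G (C.part ∋_) (ℓ + ℓ) ⊎ HasIndep G (C.part ∋_) (suc (ℓ + ℓ)) → _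
      -- The whole component is absorbed, so no new region lies inside it and there is no safety
      -- left to prove.
      go (inj₁ small) = C.part , (p , C.base , ¬Up) ,
        extend C.part D R (λ e → e) small λ R′ P′⊆P →
          let open Region R′ in contradiction (∈⁺ (∪? U C.part) (inj₂ (P′⊆P nonempty))) (disjoint nonempty)
      go (inj₂ (J , iJ , J⊆P , 2ℓ<J)) =
        let sep = separate G P5-free K-free 1≤ℓ iJ J⊆P 2ℓ<J
            safeP = Partial.safe D R
            x , Xx = cut-nonempty R safeP sep
            in-cut = ∈⁻ (cut? R safeP sep)
        in cut R safeP sep , (x , Xx , Region.disjoint R (proj₂ (in-cut Xx))) ,
          extend (cut R safeP sep) D R (proj₂ ∘ in-cut) (α≤-mono G (proj₁ ∘ in-cut) (SmallSeparation.S-small sep))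
            (safe-part R safeP sep)

    complete : ∀ {U} → Partial U → Acc _<_ (size (∁ U)) → Σ (VSet n) λ V → Partial V × ∀ v → V ∋ v
    complete {U} D (acc rec) with any? (λ v → ¬? (U ∋? v))
    ... | no full = U , D , λ v → decidable-stable (U ∋? v) λ ¬Uv → full (v , ¬Uv)
    ... | yes (p , ¬Up) with enlarge D ¬Up
    ... | X , (x , Xx , ¬Ux) , D′ = complete D′
      (rec (size-∁-strict U (U ∪ X) (λ Uv → ∈⁺ (∪? U X) (inj₁ Uv)) (∈⁺ (∪? U X) (inj₂ Xx)) ¬Ux))

    treeIndep≤ : TreeIndep≤ G (4 * ℓ)
    treeIndep≤ with complete empty-partial (<-wellFounded _)
    ... | V , D , full = record
      { m = nodes ; T = T ; isTree = isTree ; bag = bag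
      ; vertexConnected = λ v → covers (full v) , subtree v
      ; edgeCovered = λ u v → edge (full u) (full v) } ,
      λ t xs (u , B , non) → ≤-trans
        (width t (indep u λ p q e → contradiction (trans (≡-sym e) (non p q)) λ ()) B)
        (≤-reflexive (trans (+-assoc ℓ ℓ (ℓ + ℓ)) (cong (λ k → ℓ + (ℓ + (ℓ + k))) (≡-sym (+-identityʳ ℓ)))))
      where open Partial D

theorem1p4 : (ℓ : ℕ) → 1 ≤ ℓ → (n : ℕ) → (G : Graph n) →
    Free P5 G → Free (K ℓ) G → TreeIndep≤ G (4 * ℓ)
theorem1p4 ℓ 1≤ℓ n G P5-free K-free = treeIndep≤ G ℓ P5-free K-free 1≤ℓ
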